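{- Let $r\ge2$ and let $\mathcal{H}$ be a cancellative $r$-graph. Then \[ |\mathcal{H}|\le\left(\frac{|\partial\mathcal{H}|}{r}\right)^{\frac{r}{r-1}}. \]
   Context: An $r$-graph $\mathcal{H}$ is a finite vertex set $V(\mathcal{H})$ together with a set of $r$-element subsets (edges). The shadow is $\partial\mathcal{H}=\{A\in\binom{V(\mathcal{H})}{r-1}: A\subset B\text{ for some }B\in\mathcal{H}\}$. $\mathcal{T}_r$ is the collection of all $r$-graphs on at most $2r-1$ vertices with $3$ edges $A,B,C$ such that $A\triangle B\subset C$; an $r$-graph is cancellative iff it contains no member of $\mathcal{T}_r$ as a (not necessarily induced) subgraph. -}

module Defs where

open import Data.Nat using (ℕ; zero; suc; _+_; _*_; _∸_; _^_; _≤_; _≡ᵇ_)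
open import Data.Bool using (Bool; true; false; _∧_; T)
open import Data.List using (List; []; _∷_; _++_; map; filter; length)
open import Data.Bool.ListAction using (any)
open import Data.Fin.Subset using (Subset; inside; outside; ∣_∣; _⊆_; _∪_; _─_)
open import Data.Fin.Subset.Properties using (_⊆?_)
open import Data.Vec using ([]; _∷_)
open import Data.Product using (∃-syntax; _×_)
open import Relation.Nullary using (¬_; ⌊_⌋)
open import Relation.Binary.PropositionalEquality using (_≡_; _≢_)

allSubsets : (n : ℕ) → List (Subset n)
allSubsets zero = [] ∷ []
allSubsets (suc n) = map (outside ∷_) (allSubsets n) ++ map (inside ∷_) (allSubsets n)

record RGraph (r : ℕ) : Set where
  field
    n       : ℕ
    edge    : Subset n → Bool
    uniform : (S : Subset n) → T (edge S) → ∣ S ∣ ≡ r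
open RGraph public

size : ∀ {r} → RGraph r → ℕ
size H = length (filter (λ S → T? (edge H S)) (allSubsets (n H)))
  where
  open import Data.Bool.Properties using () renaming (T? to T?)

inShadow : ∀ {r} → (H : RGraph r) → Subset (n H) → Bool
inShadow {r} H A =
  (∣ A ∣ ≡ᵇ (r ∸ 1)) ∧ any (λ B → edge H B ∧ ⌊ A ⊆? B ⌋) (allSubsets (n H))

shadowSize : ∀ {r} → RGraph r → ℕ
shadowSize H = length (filter (λ A → T? (inShadow H A)) (allSubsets (n H)))
  where
  open import Data.Bool.Properties using () renaming (T? to T?)

_△_ : ∀ {m} → Subset m → Subset m → Subset m
A △ B = (A ─ B) ∪ (B ─ A)

-- H contains a member of T_r as a subgraph: three distinct edges A, B, C
-- spanning at most 2r-1 vertices with A △ B ⊆ C.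
ContainsT : ∀ {r} → RGraph r → Set
ContainsT {r} H =
  ∃[ A ] ∃[ B ] ∃[ C ]
    (T (edge H A) × T (edge H B) × T (edge H C)
     × A ≢ B × B ≢ C × A ≢ C
     × ∣ A ∪ (B ∪ C) ∣ ≤ (2 * r) ∸ 1
     × (A △ B) ⊆ C)

Cancellative : ∀ {r} → RGraph r → Set
Cancellative H = ¬ ContainsT H

{-# OPTIONS --safe #-}

-- The proof is by induction on r.  Write m = ∣H∣, s = ∣∂H∣, and for a vertex v let
-- d_v and σ_v be the numbers of edges and of shadow sets of its link.  Then
-- Σ d_v = r m and Σ σ_v ≤ (r ∸ 1) s.  If v and w lie in an edge E, no set A lies in
-- both links, for otherwise (A ∪ v) △ (A ∪ w) = {v , w} ⊆ E.  As every link is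
-- contained in ∂H, the degrees of the vertices of any edge add up to at most s, and
-- summing over the edges gives Σ d_v² ≤ m s.  The induction hypothesis bounds σ_v
-- below in terms of d_v, and the three sums combine by Hölder's inequality.  To stay
-- within ℕ, Hölder is replaced by a weighted AM-GM at each vertex, with weights scaled
-- so that both terms are equal in the balanced complete r-partite case, where
-- r m / s is the common size of the parts.
module Submission where

open import Defs
open import Data.Bool using (Bool; true; false; _∧_; not; T)
open import Data.Bool.Properties using (T?; T-∧; T-≡)
open import Data.Fin using (Fin; zero; suc)
import Data.Fin as Fin using (suc)
import Data.Fin.Properties as Fin
open import Data.Fin.Subset using (Subset; inside; outside; ∣_∣; _∈_; _∉_; _⊆_; _∪_; _∩_; _─_)
open import Data.Fin.Subset.Properties
open import Data.List using (List; []; _∷_; _++_; map; filter; length; allFin; tabulate)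
open import Data.List.Properties using (map-++; map-∘; map-cong; map-tabulate)
open import Data.List.Membership.Propositional using (lose) renaming (_∈_ to _∈ˡ_)
open import Data.List.Membership.Propositional.Properties using (∈-map⁺; ∈-++⁺ˡ; ∈-++⁺ʳ)
open import Data.List.Relation.Unary.All as All using (All; []; _∷_)
open import Data.List.Relation.Unary.AllPairs as AllPairs using (AllPairs; []; _∷_)
open import Data.List.Relation.Unary.Any using (here; satisfied)
open import Data.List.Relation.Unary.Any.Properties using (any⁺; any⁻)
open import Data.List.Relation.Unary.Unique.Propositional.Properties using (allFin⁺)
open import Data.Nat using (ℕ; zero; suc; _+_; _*_; _∸_; _^_; _≤_; _<_; _≤?_;
  NonZero; >-nonZero; >-nonZero⁻¹; ≢-nonZero; z≤n; s≤s)
open import Data.Nat.ListAction using (sum)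
open import Data.Nat.ListAction.Properties using (sum-++)
open import Data.Nat.Properties
open import Data.Nat.Tactic.RingSolver using (solve-∀)
open import Data.Product using (_×_; _,_; proj₁; proj₂; ∃-syntax)
open import Data.Sum using (_⊎_; inj₁; inj₂; [_,_]′)
open import Data.Vec using ([]; _∷_; lookup; _[_]≔_; here; there)
open import Data.Vec.Properties using ([]=⇒lookup; lookup⇒[]=; []≔-updates; []≔-minimal; lookup∘update′)
open import Function using (_∘_; id)
open import Function.Bundles using (Equivalence)
open import Relation.Nullary using (¬_; yes; no; contradiction)
open import Relation.Nullary.Decidable using (toWitness; fromWitness)
open import Relation.Binary.PropositionalEquality using (_≡_; _≢_; refl; sym; trans;
  cong; cong₂; subst; subst₂; module ≡-Reasoning)

-- Arithmetic

^-distribʳ-* : ∀ m n o → (m * n) ^ o ≡ m ^ o * n ^ o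
^-distribʳ-* m n zero    = refl
^-distribʳ-* m n (suc o) =
  trans (cong (m * n *_) (^-distribʳ-* m n o)) (shuffle m n (m ^ o) (n ^ o))
  where
  shuffle : ∀ a b c d → a * b * (c * d) ≡ a * c * (b * d)
  shuffle = solve-∀

^-cancelʳ-≤ : ∀ m n o .{{_ : NonZero o}} → m ^ o ≤ n ^ o → m ≤ n
^-cancelʳ-≤ m n o m^o≤n^o with m ≤? n
... | yes m≤n = m≤n
... | no  m≰n = contradiction m^o≤n^o (<⇒≱ (^-monoˡ-< o (≰⇒> m≰n)))

2xy≤x²+y² : ∀ x y → 2 * (x * y) ≤ x * x + y * y
2xy≤x²+y² x y with ≤-total x y
... | inj₁ x≤y with d , refl ← m≤n⇒∃[o]m+o≡n x≤y =
  ≤-trans (m≤m+n _ (d * d)) (≤-reflexive (square x d))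
  where
  square : ∀ x d → 2 * (x * (x + d)) + d * d ≡ x * x + (x + d) * (x + d)
  square = solve-∀
... | inj₂ y≤x with d , refl ← m≤n⇒∃[o]m+o≡n y≤x =
  ≤-trans (m≤m+n _ (d * d)) (≤-reflexive (square y d))
  where
  square : ∀ y d → 2 * ((y + d) * y) + d * d ≡ (y + d) * (y + d) + y * y
  square = solve-∀

-- The graph of y ↦ y ^ (k + 1) lies above its tangent at y = x.
tangent-≤ : ∀ k x y → suc k * (y * x ^ k) ≤ y ^ suc k + k * x ^ suc k
tangent-≤ zero    x y = ≤-reflexive (base y)
  where
  base : ∀ y → 1 * (y * 1) ≡ y * 1 + 0
  base = solve-∀
-- Adding k x^(k+1) y to both sides avoids subtraction: 2xy ≤ x² + y², multiplied by (k+1) x^k, then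
-- leaves y times the induction hypothesis.
tangent-≤ (suc k) x y = +-cancelʳ-≤ (k * (x * X * y)) _ _ (begin
  (2 + k) * (y * (x * X)) + k * (x * X * y)             ≡⟨ lhs k x y X ⟩
  suc k * X * (2 * (x * y))                             ≤⟨ *-monoʳ-≤ (suc k * X) (2xy≤x²+y² x y) ⟩
  suc k * X * (x * x + y * y)                           ≡⟨ mid k x y X ⟩
  y * (suc k * (y * X)) + suc k * (x * (x * X))         ≤⟨ +-monoˡ-≤ _ (*-monoʳ-≤ y (tangent-≤ k x y)) ⟩
  y * (Y + k * (x * X)) + suc k * (x * (x * X))         ≡⟨ rhs k x y X Y ⟩
  y * Y + suc k * (x * (x * X)) + k * (x * X * y)       ∎)
  where
  open ≤-Reasoning
  X = x ^ k
  Y = y ^ suc k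
  lhs : ∀ k x y X → (2 + k) * (y * (x * X)) + k * (x * X * y) ≡ (1 + k) * X * (2 * (x * y))
  lhs = solve-∀
  mid : ∀ k x y X → (1 + k) * X * (x * x + y * y) ≡ y * ((1 + k) * (y * X)) + (1 + k) * (x * (x * X))
  mid = solve-∀
  rhs : ∀ k x y X Y → y * (Y + k * (x * X)) + (1 + k) * (x * (x * X))
      ≡ y * Y + (1 + k) * (x * (x * X)) + k * (x * X * y)
  rhs = solve-∀

-- AM-GM for k copies of a / k and one copy of b, with denominators cleared. It is `tangent-≤` at x
-- = (k+1) a and y = k (a + b), two points that coincide in the equality case a = k b; the x^(k+1)
-- term cancels the part of the left side that is free of b.
weighted-AM-GM : ∀ k a b .{{_ : NonZero k}} →
  suc k ^ suc k * (a ^ k * b) ≤ k ^ k * (a + b) ^ suc k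
weighted-AM-GM k a b = *-cancelˡ-≤ k (+-cancelʳ-≤ (k * (x * X)) _ _ (begin
  k * (suc k * K * (a ^ k * b)) + k * (x * X)   ≡⟨ cong (λ z → k * (suc k * K * (a ^ k * b)) + k * (x * z)) X≡ ⟩
  k * (suc k * K * (a ^ k * b)) + k * (x * (K * a ^ k)) ≡⟨ lhs k K (a ^ k) a b ⟩
  suc k * (y * (K * a ^ k))                      ≡⟨ cong (λ z → suc k * (y * z)) X≡ ⟨
  suc k * (y * X)                                ≤⟨ tangent-≤ k x y ⟩
  y ^ suc k + k * (x * X)                        ≡⟨ cong (_+ k * (x * X)) (^-distribʳ-* k (a + b) (suc k)) ⟩
  k * k ^ k * (a + b) ^ suc k + k * (x * X)      ≡⟨ cong (_+ k * (x * X)) (*-assoc k (k ^ k) _) ⟩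
  k * (k ^ k * (a + b) ^ suc k) + k * (x * X)    ∎))
  where
  open ≤-Reasoning
  x = suc k * a
  y = k * (a + b)
  X = x ^ k
  K = suc k ^ k
  X≡ : X ≡ K * a ^ k
  X≡ = ^-distribʳ-* (suc k) a k
  lhs : ∀ k K A a b → k * ((1 + k) * K * (A * b)) + k * ((1 + k) * a * (K * A))
      ≡ (1 + k) * (k * (a + b) * (K * A))
  lhs = solve-∀

-- Weighted AM-GM for k copies of p ^ (k + 1) * σ / k and one of q ^ (k + 1) * d ².
linearisation : ∀ j d σ p q → let k = suc j in k ^ k * d ^ j ≤ σ ^ k →
  suc k * (p ^ k * (q * d)) ≤ p ^ suc k * σ + q ^ suc k * (d * d)
linearisation j d σ p q hyp = ^-cancelʳ-≤ _ _ (suc k) (*-cancelˡ-≤ (k ^ k) {{m^n≢0 k k}} (begin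
  k ^ k * (suc k * c) ^ suc k                      ≡⟨ cong (k ^ k *_) (^-distribʳ-* (suc k) c (suc k)) ⟩
  k ^ k * (suc k ^ suc k * c ^ suc k)              ≡⟨ swap (k ^ k) (suc k ^ suc k) _ ⟩
  suc k ^ suc k * (k ^ k * c ^ suc k)              ≤⟨ *-monoʳ-≤ (suc k ^ suc k) c-bound ⟩
  suc k ^ suc k * (a ^ k * b)                      ≤⟨ weighted-AM-GM k a b ⟩
  k ^ k * (a + b) ^ suc k                          ∎))
  where
  open ≤-Reasoning
  k = suc j
  c = p ^ k * (q * d)
  a = p ^ suc k * σ
  b = q ^ suc k * (d * d)
  swap : ∀ x y z → x * (y * z) ≡ y * (x * z)
  swap = solve-∀
  regroup : ∀ K P Q d D → K * (P * (Q * (d * (d * D)))) ≡ K * D * (P * (Q * (d * d)))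
  regroup = solve-∀
  regroup′ : ∀ S P Q → S * (P * Q) ≡ P * S * Q
  regroup′ = solve-∀
  c-expand : c ^ suc k ≡ p ^ (k * suc k) * (q ^ suc k * d ^ suc k)
  c-expand = trans (^-distribʳ-* (p ^ k) (q * d) (suc k))
    (cong₂ _*_ (^-*-assoc p k (suc k)) (^-distribʳ-* q d (suc k)))
  a-expand : a ^ k ≡ p ^ (k * suc k) * σ ^ k
  a-expand = trans (^-distribʳ-* (p ^ suc k) σ k)
    (cong (_* σ ^ k) (trans (^-*-assoc p (suc k) k) (cong (p ^_) (*-comm (suc k) k))))
  -- The power `c ^ suc k` contains d^(k+1) = d² d^j. The factor d^j, together with k^k, is what
  -- `hyp` trades for σ^k; the factor d² stays in `b`.
  c-bound : k ^ k * c ^ suc k ≤ a ^ k * b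
  c-bound = begin
    k ^ k * c ^ suc k                                                   ≡⟨ cong (k ^ k *_) c-expand ⟩
    k ^ k * (p ^ (k * suc k) * (q ^ suc k * (d * (d * d ^ j))))         ≡⟨ regroup (k ^ k) (p ^ (k * suc k)) (q ^ suc k) d (d ^ j) ⟩
    k ^ k * d ^ j * (p ^ (k * suc k) * b)                               ≤⟨ *-monoˡ-≤ _ hyp ⟩
    σ ^ k * (p ^ (k * suc k) * b)                                       ≡⟨ regroup′ (σ ^ k) (p ^ (k * suc k)) b ⟩
    p ^ (k * suc k) * σ ^ k * b                                         ≡⟨ cong (_* b) a-expand ⟨
    a ^ k * b                                                           ∎

-- Finite sums

∑ : {A : Set} → List A → (A → ℕ) → ℕ
∑ xs f = sum (map f xs)

⟦_⟧ : Bool → ℕ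
⟦ true  ⟧ = 1
⟦ false ⟧ = 0

module _ {A : Set} where

  ∑-cong : ∀ (xs : List A) {f g : A → ℕ} → (∀ x → f x ≡ g x) → ∑ xs f ≡ ∑ xs g
  ∑-cong xs f≗g = cong sum (map-cong f≗g xs)

  ∑-mono : ∀ (xs : List A) {f g : A → ℕ} → (∀ x → f x ≤ g x) → ∑ xs f ≤ ∑ xs g
  ∑-mono []       f≤g = z≤n
  ∑-mono (x ∷ xs) f≤g = +-mono-≤ (f≤g x) (∑-mono xs f≤g)

  ∑-+ : ∀ (xs : List A) (f g : A → ℕ) → ∑ xs (λ x → f x + g x) ≡ ∑ xs f + ∑ xs g
  ∑-+ []       f g = refl
  ∑-+ (x ∷ xs) f g = trans (cong (f x + g x +_) (∑-+ xs f g)) (interchange (f x) (g x) (∑ xs f) (∑ xs g))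
    where
    interchange : ∀ a b c d → a + b + (c + d) ≡ a + c + (b + d)
    interchange = solve-∀

  ∑-*ˡ : ∀ (xs : List A) c (f : A → ℕ) → ∑ xs (λ x → c * f x) ≡ c * ∑ xs f
  ∑-*ˡ []       c f = sym (*-zeroʳ c)
  ∑-*ˡ (x ∷ xs) c f = trans (cong (c * f x +_) (∑-*ˡ xs c f)) (sym (*-distribˡ-+ c (f x) (∑ xs f)))

  ∑-const : ∀ (xs : List A) c → ∑ xs (λ _ → c) ≡ length xs * c
  ∑-const []       c = refl
  ∑-const (x ∷ xs) c = cong (c +_) (∑-const xs c)

  ∑-none : ∀ {f : A → Bool} {xs} → All (λ x → ¬ T (f x)) xs → ∑ xs (λ x → ⟦ f x ⟧) ≡ 0
  ∑-none         []         = refl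
  ∑-none {f = f} (_∷_ {x} ¬fx ¬fs) with f x
  ... | true  = contradiction _ ¬fx
  ... | false = ∑-none ¬fs

  -- Turns pairwise exclusion into a bound under a sum: it will show that a fixed set lies in the
  -- link of at most one vertex of an edge.
  ∑-atMostOne : ∀ {f : A → Bool} {b} → (∀ x → T (f x) → T b) →
    ∀ {xs} → AllPairs (λ x y → ¬ (T (f x) × T (f y))) xs → ∑ xs (λ x → ⟦ f x ⟧) ≤ ⟦ b ⟧
  ∑-atMostOne f⇒b [] = z≤n
  ∑-atMostOne {f} {b} f⇒b (_∷_ {x} ¬fx∧fy ¬fs) with f x | f⇒b x
  ... | false | _ = ∑-atMostOne f⇒b ¬fs
  ... | true  | ⇒b with b | ⇒b _
  ...   | true | _ = ≤-reflexive (cong suc (∑-none (All.map (λ ¬p fy → ¬p (_ , fy)) ¬fx∧fy)))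

  length-filter-T : ∀ (f : A → Bool) xs → length (filter (λ x → T? (f x)) xs) ≡ ∑ xs (λ x → ⟦ f x ⟧)
  length-filter-T f [] = refl
  length-filter-T f (x ∷ xs) with f x
  ... | true  = cong suc (length-filter-T f xs)
  ... | false = length-filter-T f xs

∑-swap : {A B : Set} (xs : List A) (ys : List B) (f : A → B → ℕ) →
  ∑ xs (λ x → ∑ ys (f x)) ≡ ∑ ys (λ y → ∑ xs (λ x → f x y))
∑-swap []       ys f = sym (trans (∑-const ys 0) (*-zeroʳ (length ys)))
∑-swap (x ∷ xs) ys f = trans (cong (∑ ys (f x) +_) (∑-swap xs ys f)) (sym (∑-+ ys (f x) _))

⟦⟧-∧ : ∀ a b → ⟦ a ∧ b ⟧ ≡ ⟦ a ⟧ * ⟦ b ⟧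
⟦⟧-∧ true  b = sym (+-identityʳ ⟦ b ⟧)
⟦⟧-∧ false b = refl

⟦⟧-mono : ∀ {a b} → (T a → T b) → ⟦ a ⟧ ≤ ⟦ b ⟧
⟦⟧-mono {false}         _   = z≤n
⟦⟧-mono {true}  {true}  _   = ≤-refl
⟦⟧-mono {true}  {false} a⇒b = contradiction _ a⇒b

-- Allows a bound known only for edges to be applied inside a sum over all subsets.
⟦⟧-*-mono : ∀ b {x y} → (T b → x ≤ y) → ⟦ b ⟧ * x ≤ ⟦ b ⟧ * y
⟦⟧-*-mono true  x≤y = *-monoʳ-≤ 1 (x≤y _)
⟦⟧-*-mono false _   = z≤n

-- Subsets

∈─⇒∉ : ∀ {n} (p q : Subset n) {x} → x ∈ p ─ q → x ∉ q
∈─⇒∉ (_ ∷ _) (outside ∷ _) here        ()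
∈─⇒∉ (_ ∷ p) (_ ∷ q)       (there x∈─) (there x∈q) = ∈─⇒∉ p q x∈─ x∈q

module _ {n : ℕ} where

  T⇒∈ : ∀ {v} {S : Subset n} → T (lookup S v) → v ∈ S
  T⇒∈ {v} {S} = lookup⇒[]= v S ∘ Equivalence.to T-≡

  insert : Subset n → Fin n → Subset n
  insert S v = S [ v ]≔ inside

  v∈insert : ∀ (S : Subset n) v → v ∈ insert S v
  v∈insert = []≔-updates

  ⊆insert : ∀ (S : Subset n) v → S ⊆ insert S v
  ⊆insert S v {x} x∈S with x Fin.≟ v
  ... | yes refl = v∈insert S v
  ... | no  x≢v  = []≔-minimal S x v x≢v x∈S

  ∈insert⁻ : ∀ (S : Subset n) v {x} → x ∈ insert S v → x ≡ v ⊎ x ∈ S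
  ∈insert⁻ S v {x} x∈ with x Fin.≟ v
  ... | yes x≡v = inj₁ x≡v
  ... | no  x≢v = inj₂ (lookup⇒[]= x S (trans (sym (lookup∘update′ x≢v S inside)) ([]=⇒lookup x∈)))

  insert-mono : ∀ {A B : Subset n} v → A ⊆ B → insert A v ⊆ insert B v
  insert-mono {A} {B} v A⊆B x∈ with ∈insert⁻ A v x∈
  ... | inj₁ refl = v∈insert B v
  ... | inj₂ x∈A  = ⊆insert B v (A⊆B x∈A)

  insert⊆⇒⊆ : ∀ {A B : Subset n} {v} → v ∉ A → insert A v ⊆ insert B v → A ⊆ B
  insert⊆⇒⊆ {A} {B} {v} v∉A A⁺⊆B⁺ x∈A with ∈insert⁻ B v (A⁺⊆B⁺ (⊆insert A v x∈A))
  ... | inj₁ refl = contradiction x∈A v∉A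
  ... | inj₂ x∈B  = x∈B

  ∈△⁻ : ∀ (A B : Subset n) {x} → x ∈ A △ B → (x ∈ A × x ∉ B) ⊎ (x ∈ B × x ∉ A)
  ∈△⁻ A B x∈ with x∈p∪q⁻ (A ─ B) (B ─ A) x∈
  ... | inj₁ x∈A─B = inj₁ (p─q⊆p A B x∈A─B , ∈─⇒∉ A B x∈A─B)
  ... | inj₂ x∈B─A = inj₂ (p─q⊆p B A x∈B─A , ∈─⇒∉ B A x∈B─A)

  ∈△⁺ : ∀ (A B : Subset n) {x} → (x ∈ A × x ∉ B) ⊎ (x ∈ B × x ∉ A) → x ∈ A △ B
  ∈△⁺ A B (inj₁ (x∈A , x∉B)) = x∈p∪q⁺ (inj₁ (x∈p∧x∉q⇒x∈p─q x∈A x∉B))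
  ∈△⁺ A B (inj₂ (x∈B , x∉A)) = x∈p∪q⁺ (inj₂ (x∈p∧x∉q⇒x∈p─q x∈B x∉A))

  -- The vertex v belongs to both enlarged sets and so drops out of their symmetric difference.
  insert-△-insert : ∀ (A B : Subset n) v → (insert A v △ insert B v) ⊆ (A △ B)
  insert-△-insert A B v x∈ with ∈△⁻ (insert A v) (insert B v) x∈
  ... | inj₁ (x∈A⁺ , x∉B⁺) with ∈insert⁻ A v x∈A⁺
  ...   | inj₁ refl = contradiction (v∈insert B v) x∉B⁺
  ...   | inj₂ x∈A  = ∈△⁺ A B (inj₁ (x∈A , x∉B⁺ ∘ ⊆insert B v))
  insert-△-insert A B v x∈ | inj₂ (x∈B⁺ , x∉A⁺) with ∈insert⁻ B v x∈B⁺
  ...   | inj₁ refl = contradiction (v∈insert A v) x∉A⁺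
  ...   | inj₂ x∈B  = ∈△⁺ A B (inj₂ (x∈B , x∉A⁺ ∘ ⊆insert A v))

∣insert∣ : ∀ {n} (S : Subset n) v → v ∉ S → ∣ insert S v ∣ ≡ suc ∣ S ∣
∣insert∣ (inside  ∷ S) zero    v∉S = contradiction here v∉S
∣insert∣ (outside ∷ S) zero    v∉S = refl
∣insert∣ (inside  ∷ S) (suc v) v∉S = cong suc (∣insert∣ S v (v∉S ∘ there))
∣insert∣ (outside ∷ S) (suc v) v∉S = ∣insert∣ S v (v∉S ∘ there)

∣p∪q∣≤∣p∣+∣q∣ : ∀ {n} (p q : Subset n) → ∣ p ∪ q ∣ ≤ ∣ p ∣ + ∣ q ∣
∣p∪q∣≤∣p∣+∣q∣ []            []            = z≤n
∣p∪q∣≤∣p∣+∣q∣ (inside  ∷ p) (inside  ∷ q) = s≤s (≤-trans (∣p∪q∣≤∣p∣+∣q∣ p q) (+-monoʳ-≤ ∣ p ∣ (n≤1+n ∣ q ∣)))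
∣p∪q∣≤∣p∣+∣q∣ (inside  ∷ p) (outside ∷ q) = s≤s (∣p∪q∣≤∣p∣+∣q∣ p q)
∣p∪q∣≤∣p∣+∣q∣ (outside ∷ p) (inside  ∷ q) = ≤-trans (s≤s (∣p∪q∣≤∣p∣+∣q∣ p q)) (≤-reflexive (sym (+-suc ∣ p ∣ ∣ q ∣)))
∣p∪q∣≤∣p∣+∣q∣ (outside ∷ p) (outside ∷ q) = ∣p∪q∣≤∣p∣+∣q∣ p q

⊆∧∣∣≡⇒≡ : ∀ {n} {p q : Subset n} → p ⊆ q → ∣ p ∣ ≡ ∣ q ∣ → p ≡ q
⊆∧∣∣≡⇒≡ {p = []}          {[]}          _   _  = refl
⊆∧∣∣≡⇒≡ {p = inside  ∷ p} {inside  ∷ q} p⊆q eq = cong (inside ∷_) (⊆∧∣∣≡⇒≡ (drop-∷-⊆ p⊆q) (suc-injective eq))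
⊆∧∣∣≡⇒≡ {p = inside  ∷ p} {outside ∷ q} p⊆q eq = contradiction (p⊆q here) λ ()
⊆∧∣∣≡⇒≡ {p = outside ∷ p} {inside  ∷ q} p⊆q eq = contradiction (p⊆q⇒∣p∣≤∣q∣ (drop-∷-⊆ p⊆q)) (<⇒≱ (≤-reflexive (sym eq)))
⊆∧∣∣≡⇒≡ {p = outside ∷ p} {outside ∷ q} p⊆q eq = cong (outside ∷_) (⊆∧∣∣≡⇒≡ (drop-∷-⊆ p⊆q) eq)

∈-allSubsets : ∀ {n} (S : Subset n) → S ∈ˡ allSubsets n
∈-allSubsets []            = here refl
∈-allSubsets (outside ∷ S) = ∈-++⁺ˡ (∈-map⁺ (outside ∷_) (∈-allSubsets S))
∈-allSubsets (inside  ∷ S) = ∈-++⁺ʳ _ (∈-map⁺ (inside ∷_) (∈-allSubsets S))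

-- Counting set families and their links

count : ∀ {n} → (Subset n → Bool) → ℕ
count {n} P = ∑ (allSubsets n) (λ S → ⟦ P S ⟧)

count-suc : ∀ {n} (P : Subset (suc n) → Bool) →
  count P ≡ count (λ S → P (outside ∷ S)) + count (λ S → P (inside ∷ S))
count-suc {n} P = begin
  sum (map f (map (outside ∷_) Ss ++ map (inside ∷_) Ss))           ≡⟨ cong sum (map-++ f (map (outside ∷_) Ss) _) ⟩
  sum (map f (map (outside ∷_) Ss) ++ map f (map (inside ∷_) Ss))   ≡⟨ sum-++ (map f (map (outside ∷_) Ss)) _ ⟩
  sum (map f (map (outside ∷_) Ss)) + sum (map f (map (inside ∷_) Ss)) ≡⟨ cong₂ (λ xs ys → sum xs + sum ys) (map-∘ Ss) (map-∘ Ss) ⟨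
  count (λ S → P (outside ∷ S)) + count (λ S → P (inside ∷ S))      ∎
  where
  open ≡-Reasoning
  Ss = allSubsets n
  f : Subset (suc n) → ℕ
  f S = ⟦ P S ⟧

-- The link of v in the family P. The ground set keeps v, so links at different vertices, and the
-- shadow, are families on the same `Fin n` and can be compared directly.
puncture : ∀ {n} → (Subset n → Bool) → Fin n → Subset n → Bool
puncture P v S = not (lookup S v) ∧ P (insert S v)

puncture⁻ : ∀ {n} (P : Subset n → Bool) {v S} → T (puncture P v S) → v ∉ S × T (P (insert S v))
puncture⁻ P {v} {S} t with lookup S v in eq
... | false = (λ v∈S → contradiction (trans (sym eq) ([]=⇒lookup v∈S)) λ ()) , t

puncture⁺ : ∀ {n} (P : Subset n → Bool) {v S} → v ∉ S → T (P (insert S v)) → T (puncture P v S)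
puncture⁺ P {v} {S} v∉S t with lookup S v in eq
... | false = t
... | true  = contradiction (lookup⇒[]= v S eq) v∉S

-- Adding v is a bijection from the link onto the members of P through v. The recursion walks to
-- coordinate v, where it exchanges the sets without v and those with v.
count-puncture : ∀ {n} (P : Subset n → Bool) v → count (puncture P v) ≡ count (λ S → lookup S v ∧ P S)
count-puncture {suc n} P zero = trans (count-suc (puncture P zero))
  (trans (+-comm (count (λ S → P (inside ∷ S))) _) (sym (count-suc (λ S → lookup S zero ∧ P S))))
count-puncture {suc n} P (suc v) = trans (count-suc (puncture P (suc v)))
  (trans (cong₂ _+_ (count-puncture (λ S → P (outside ∷ S)) v) (count-puncture (λ S → P (inside ∷ S)) v))
         (sym (count-suc (λ S → lookup S (suc v) ∧ P S))))

∑-lookup : ∀ {n} (S : Subset n) → ∑ (allFin n) (λ v → ⟦ lookup S v ⟧) ≡ ∣ S ∣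
∑-lookup []      = refl
∑-lookup {suc n} (s ∷ S) = trans (cong (⟦ s ⟧ +_) tail) (head s)
  where
  tail : sum (map (λ v → ⟦ lookup (s ∷ S) v ⟧) (tabulate {n = n} suc)) ≡ ∣ S ∣
  tail = trans (cong sum (trans
      (map-tabulate Fin.suc (λ v → ⟦ lookup (s ∷ S) v ⟧))
      (sym (map-tabulate id (λ v → ⟦ lookup S v ⟧)))))
    (∑-lookup S)
  head : ∀ s → ⟦ s ⟧ + ∣ S ∣ ≡ ∣ s ∷ S ∣
  head true  = refl
  head false = refl

-- Double counting of the incidences v ∈ S. Applied to the edges it gives the degree sum; applied to
-- the shadow it bounds the total size of the shadows of the links.
∑-count-puncture : ∀ {n r} (P : Subset n → Bool) → (∀ S → T (P S) → ∣ S ∣ ≡ r) →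
  ∑ (allFin n) (λ v → count (puncture P v)) ≡ r * count P
∑-count-puncture {n} {r} P uniformP = begin
  ∑ vs (λ v → count (puncture P v))                          ≡⟨ ∑-cong vs (count-puncture P) ⟩
  ∑ vs (λ v → count (λ S → lookup S v ∧ P S))                ≡⟨ ∑-swap vs Ss _ ⟩
  ∑ Ss (λ S → ∑ vs (λ v → ⟦ lookup S v ∧ P S ⟧))             ≡⟨ ∑-cong Ss pointwise ⟩
  ∑ Ss (λ S → r * ⟦ P S ⟧)                                   ≡⟨ ∑-*ˡ Ss r _ ⟩
  r * count P                                                ∎
  where
  open ≡-Reasoning
  vs = allFin n
  Ss = allSubsets n
  size-or-zero : ∀ S → ⟦ P S ⟧ * ∣ S ∣ ≡ r * ⟦ P S ⟧
  size-or-zero S with P S | uniformP S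
  ... | true  | u = trans (+-identityʳ ∣ S ∣) (trans (u _) (sym (*-identityʳ r)))
  ... | false | _ = sym (*-zeroʳ r)
  pointwise : ∀ S → ∑ vs (λ v → ⟦ lookup S v ∧ P S ⟧) ≡ r * ⟦ P S ⟧
  pointwise S = begin
    ∑ vs (λ v → ⟦ lookup S v ∧ P S ⟧)       ≡⟨ ∑-cong vs (λ v → trans (⟦⟧-∧ (lookup S v) (P S)) (*-comm ⟦ lookup S v ⟧ _)) ⟩
    ∑ vs (λ v → ⟦ P S ⟧ * ⟦ lookup S v ⟧)   ≡⟨ ∑-*ˡ vs ⟦ P S ⟧ _ ⟩
    ⟦ P S ⟧ * ∑ vs (λ v → ⟦ lookup S v ⟧)   ≡⟨ cong (⟦ P S ⟧ *_) (∑-lookup S) ⟩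
    ⟦ P S ⟧ * ∣ S ∣                         ≡⟨ size-or-zero S ⟩
    r * ⟦ P S ⟧                             ∎

-- Cancellative hypergraphs and links

size≡count : ∀ {r} (H : RGraph r) → size H ≡ count (edge H)
size≡count H = length-filter-T (edge H) (allSubsets (n H))

shadowSize≡count : ∀ {r} (H : RGraph r) → shadowSize H ≡ count (inShadow H)
shadowSize≡count H = length-filter-T (inShadow H) (allSubsets (n H))

inShadow⁺ : ∀ {r} (H : RGraph r) {A B} → ∣ A ∣ ≡ r ∸ 1 → T (edge H B) → A ⊆ B → T (inShadow H A)
inShadow⁺ {r} H {A} {B} ∣A∣≡ B∈H A⊆B = Equivalence.from T-∧
  ( ≡⇒≡ᵇ _ _ ∣A∣≡
  , any⁺ _ (lose (∈-allSubsets B) (Equivalence.from T-∧ (B∈H , fromWitness {a? = A ⊆? B} A⊆B))))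

inShadow⁻ : ∀ {r} (H : RGraph r) {A} → T (inShadow H A) → ∣ A ∣ ≡ r ∸ 1 × ∃[ B ] (T (edge H B) × A ⊆ B)
inShadow⁻ {r} H {A} t =
  let ∣A∣≡ , hasB = Equivalence.to T-∧ t
      B , tB      = satisfied (any⁻ _ (allSubsets (n H)) hasB)
      B∈H , A⊆?B  = Equivalence.to T-∧ tB
  in ≡ᵇ⇒≡ ∣ A ∣ (r ∸ 1) ∣A∣≡ , B , B∈H , λ {x} → toWitness {a? = A ⊆? B} A⊆?B {x}

SymDiffFree : ∀ {r} → RGraph r → Set
SymDiffFree H = ∀ {A B C} → T (edge H A) → T (edge H B) → T (edge H C) → A ≢ B → ¬ (A △ B) ⊆ C

-- Since A △ B ⊆ C, the three edges lie in (A ∩ B) ∪ C, where ∣ A ∩ B ∣ < r;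
-- and C is distinct from A and B because neither of these contains the other.
cancellative⇒symDiffFree : ∀ {r} (H : RGraph r) → Cancellative H → SymDiffFree H
cancellative⇒symDiffFree {r} H cancel {A} {B} {C} A∈H B∈H C∈H A≢B △⊆C =
  cancel (A , B , C , A∈H , B∈H , C∈H , A≢B , B≢C , A≢C , few , △⊆C)
  where
  ∣A∣≡∣B∣ : ∣ A ∣ ≡ ∣ B ∣
  ∣A∣≡∣B∣ = trans (uniform H A A∈H) (sym (uniform H B B∈H))
  A⊈B : ¬ A ⊆ B
  A⊈B A⊆B = A≢B (⊆∧∣∣≡⇒≡ A⊆B ∣A∣≡∣B∣)
  B⊈A : ¬ B ⊆ A
  B⊈A B⊆A = A≢B (sym (⊆∧∣∣≡⇒≡ B⊆A (sym ∣A∣≡∣B∣)))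
  B≢C : B ≢ C
  B≢C refl = A⊈B A⊆B
    where
    A⊆B : A ⊆ B
    A⊆B {x} x∈A with x ∈? B
    ... | yes x∈B = x∈B
    ... | no  x∉B = △⊆C (∈△⁺ A B (inj₁ (x∈A , x∉B)))
  A≢C : A ≢ C
  A≢C refl = B⊈A B⊆A
    where
    B⊆A : B ⊆ A
    B⊆A {x} x∈B with x ∈? A
    ... | yes x∈A = x∈A
    ... | no  x∉A = △⊆C (∈△⁺ A B (inj₂ (x∈B , x∉A)))
  ∣A∩B∣<r : ∣ A ∩ B ∣ < r
  ∣A∩B∣<r = ≤∧≢⇒< (≤-trans (∣p∩q∣≤∣p∣ A B) (≤-reflexive (uniform H A A∈H)))
    λ eq → A⊈B (subst (_⊆ B) (⊆∧∣∣≡⇒≡ (p∩q⊆p A B) (trans eq (sym (uniform H A A∈H)))) (p∩q⊆q A B))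
  covered : A ∪ (B ∪ C) ⊆ (A ∩ B) ∪ C
  covered {x} x∈ with x ∈? C
  ... | yes x∈C = x∈p∪q⁺ (inj₂ x∈C)
  ... | no  x∉C with x ∈? A | x ∈? B
  ...   | yes x∈A | yes x∈B = x∈p∪q⁺ (inj₁ (x∈p∩q⁺ (x∈A , x∈B)))
  ...   | yes x∈A | no  x∉B = contradiction (△⊆C (∈△⁺ A B (inj₁ (x∈A , x∉B)))) x∉C
  ...   | no  x∉A | yes x∈B = contradiction (△⊆C (∈△⁺ A B (inj₂ (x∈B , x∉A)))) x∉C
  ...   | no  x∉A | no  x∉B with x∈p∪q⁻ A (B ∪ C) x∈
  ...     | inj₁ x∈A   = contradiction x∈A x∉A
  ...     | inj₂ x∈B∪C = [ (λ x∈B → contradiction x∈B x∉B) , (λ x∈C → contradiction x∈C x∉C) ]′ (x∈p∪q⁻ B C x∈B∪C)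
  few : ∣ A ∪ (B ∪ C) ∣ ≤ 2 * r ∸ 1
  few = begin
    ∣ A ∪ (B ∪ C) ∣     ≤⟨ p⊆q⇒∣p∣≤∣q∣ covered ⟩
    ∣ (A ∩ B) ∪ C ∣     ≤⟨ ∣p∪q∣≤∣p∣+∣q∣ (A ∩ B) C ⟩
    ∣ A ∩ B ∣ + ∣ C ∣   ≤⟨ <⇒≤pred (+-mono-<-≤ ∣A∩B∣<r (≤-reflexive (uniform H C C∈H))) ⟩
    r + r ∸ 1           ≡⟨ cong (λ x → r + x ∸ 1) (+-identityʳ r) ⟨
    2 * r ∸ 1           ∎
    where open ≤-Reasoning

link : ∀ {r} (H : RGraph (suc r)) → Fin (n H) → RGraph r
link H v .n    = n H
link H v .edge = puncture (edge H) v
link H v .uniform S S∈ =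
  let v∉S , S⁺∈H = puncture⁻ (edge H) S∈
  in suc-injective (trans (sym (∣insert∣ S v v∉S)) (uniform H (insert S v) S⁺∈H))

-- A forbidden triple in the link lifts to H by adding v to all three sets: A and B stay distinct
-- because neither contains v, and their symmetric difference does not grow.
link-symDiffFree : ∀ {r} (H : RGraph (suc r)) v → SymDiffFree H → SymDiffFree (link H v)
link-symDiffFree H v free {A} {B} {C} A∈ B∈ C∈ A≢B △⊆C =
  let v∉A , A⁺∈H = puncture⁻ (edge H) A∈
      v∉B , B⁺∈H = puncture⁻ (edge H) B∈
      _   , C⁺∈H = puncture⁻ (edge H) C∈
  in free A⁺∈H B⁺∈H C⁺∈H
       (λ eq → A≢B (⊆-antisym (insert⊆⇒⊆ v∉A (⊆-reflexive eq)) (insert⊆⇒⊆ v∉B (⊆-reflexive (sym eq)))))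
       (⊆insert C v ∘ △⊆C ∘ insert-△-insert A B v)

-- Sums of degrees, squared degrees and link shadows

module _ {r} (H : RGraph (suc r)) where

  private
    vs = allFin (n H)
    Ss = allSubsets (n H)

  link⊆shadow : ∀ v {A} → T (edge (link H v) A) → T (inShadow H A)
  link⊆shadow v {A} A∈ =
    inShadow⁺ H (uniform (link H v) A A∈) (proj₂ (puncture⁻ (edge H) A∈)) (⊆insert A v)

  ∑-size-link : ∑ vs (λ v → size (link H v)) ≡ suc r * size H
  ∑-size-link = trans (∑-cong vs (λ v → size≡count (link H v)))
    (trans (∑-count-puncture (edge H) (uniform H)) (cong (suc r *_) (sym (size≡count H))))

  size-link≤shadowSize : ∀ v → size (link H v) ≤ shadowSize H
  size-link≤shadowSize v = subst₂ _≤_ (sym (size≡count (link H v))) (sym (shadowSize≡count H))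
    (∑-mono Ss (λ A → ⟦⟧-mono (link⊆shadow v)))

  -- Every degree is at most the size of the shadow, so an empty shadow would make the positive
  -- degree sum vanish.
  shadow≢∅ : .{{_ : NonZero (size H)}} → NonZero (shadowSize H)
  shadow≢∅ = m*n≢0⇒n≢0 (length vs) {{>-nonZero (begin-strict
    0                              <⟨ >-nonZero⁻¹ (suc r * size H) {{m*n≢0 (suc r) (size H)}} ⟩
    suc r * size H                 ≡⟨ ∑-size-link ⟨
    ∑ vs (λ v → size (link H v))   ≤⟨ ∑-mono vs size-link≤shadowSize ⟩
    ∑ vs (λ _ → shadowSize H)      ≡⟨ ∑-const vs (shadowSize H) ⟩
    length vs * shadowSize H       ∎)}}
    where open ≤-Reasoning

  module _ (free : SymDiffFree H) where

    links-disjoint : ∀ {E A v w} → T (edge H E) → v ∈ E → w ∈ E → v ≢ w →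
      T (edge (link H v) A) → ¬ T (edge (link H w) A)
    links-disjoint {E} {A} {v} {w} E∈H v∈E w∈E v≢w A∈v A∈w =
      free A⁺v∈H A⁺w∈H E∈H A⁺v≢A⁺w △⊆E
      where
      v∉A = proj₁ (puncture⁻ (edge H) A∈v)
      A⁺v∈H = proj₂ (puncture⁻ (edge H) A∈v)
      A⁺w∈H = proj₂ (puncture⁻ (edge H) A∈w)
      A⁺v≢A⁺w : insert A v ≢ insert A w
      A⁺v≢A⁺w eq with ∈insert⁻ A w (subst (v ∈_) eq (v∈insert A v))
      ... | inj₁ v≡w = v≢w v≡w
      ... | inj₂ v∈A = v∉A v∈A
      △⊆E : (insert A v △ insert A w) ⊆ E
      △⊆E x∈ with ∈△⁻ (insert A v) (insert A w) x∈
      ... | inj₁ (x∈ , x∉) = [ (λ where refl → v∈E) , (λ x∈A → contradiction (⊆insert A w x∈A) x∉) ]′ (∈insert⁻ A v x∈)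
      ... | inj₂ (x∈ , x∉) = [ (λ where refl → w∈E) , (λ x∈A → contradiction (⊆insert A v x∈A) x∉) ]′ (∈insert⁻ A w x∈)

    -- Count the pairs of a vertex v of E and a set A in its link by A instead of v: by
    -- `links-disjoint` each A has at most one such v, and it lies in the shadow.
    edge-degree-sum : ∀ {E} → T (edge H E) →
      ∑ vs (λ v → ⟦ lookup E v ⟧ * size (link H v)) ≤ shadowSize H
    edge-degree-sum {E} E∈H = begin
      ∑ vs (λ v → ⟦ lookup E v ⟧ * size (link H v))          ≡⟨ ∑-cong vs expand ⟩
      ∑ vs (λ v → ∑ Ss (λ A → ⟦ lookup E v ∧ edge (link H v) A ⟧)) ≡⟨ ∑-swap vs Ss _ ⟩
      ∑ Ss (λ A → ∑ vs (λ v → ⟦ lookup E v ∧ edge (link H v) A ⟧)) ≤⟨ ∑-mono Ss atMostOne ⟩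
      count (inShadow H)                                     ≡⟨ shadowSize≡count H ⟨
      shadowSize H                                           ∎
      where
      open ≤-Reasoning
      expand : ∀ v → ⟦ lookup E v ⟧ * size (link H v) ≡ ∑ Ss (λ A → ⟦ lookup E v ∧ edge (link H v) A ⟧)
      expand v = trans (cong (⟦ lookup E v ⟧ *_) (size≡count (link H v)))
        (trans (sym (∑-*ˡ Ss ⟦ lookup E v ⟧ _)) (∑-cong Ss (λ A → sym (⟦⟧-∧ (lookup E v) _))))
      atMostOne : ∀ A → ∑ vs (λ v → ⟦ lookup E v ∧ edge (link H v) A ⟧) ≤ ⟦ inShadow H A ⟧
      atMostOne A = ∑-atMostOne
        (λ v t → link⊆shadow v (proj₂ (Equivalence.to (T-∧ {lookup E v}) t)))
        (AllPairs.map
          (λ {v} {w} v≢w (tv , tw) →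
            let v∈E , A∈v = Equivalence.to (T-∧ {lookup E v}) tv
                w∈E , A∈w = Equivalence.to (T-∧ {lookup E w}) tw
            in links-disjoint E∈H (T⇒∈ v∈E) (T⇒∈ w∈E) v≢w A∈v A∈w)
          (allFin⁺ (n H)))

    -- One factor of each square is expanded as the number of edges through v. Exchanging the sums
    -- then gives, for every edge, the sum of the degrees of its vertices.
    ∑-size-link² : ∑ vs (λ v → size (link H v) * size (link H v)) ≤ size H * shadowSize H
    ∑-size-link² = begin
      ∑ vs (λ v → d v * d v)                                              ≡⟨ ∑-cong vs expand ⟩
      ∑ vs (λ v → ∑ Ss (λ E → ⟦ edge H E ⟧ * (⟦ lookup E v ⟧ * d v)))     ≡⟨ ∑-swap vs Ss _ ⟩
      ∑ Ss (λ E → ∑ vs (λ v → ⟦ edge H E ⟧ * (⟦ lookup E v ⟧ * d v)))     ≡⟨ ∑-cong Ss (λ E → ∑-*ˡ vs ⟦ edge H E ⟧ _) ⟩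
      ∑ Ss (λ E → ⟦ edge H E ⟧ * ∑ vs (λ v → ⟦ lookup E v ⟧ * d v))       ≤⟨ ∑-mono Ss (λ E → ⟦⟧-*-mono (edge H E) edge-degree-sum) ⟩
      ∑ Ss (λ E → ⟦ edge H E ⟧ * s)                                       ≡⟨ ∑-cong Ss (λ E → *-comm ⟦ edge H E ⟧ s) ⟩
      ∑ Ss (λ E → s * ⟦ edge H E ⟧)                                       ≡⟨ ∑-*ˡ Ss s _ ⟩
      s * count (edge H)                                                  ≡⟨ cong (s *_) (size≡count H) ⟨
      s * size H                                                          ≡⟨ *-comm s (size H) ⟩
      size H * s                                                          ∎
      where
      open ≤-Reasoning
      s = shadowSize H
      d : Fin (n H) → ℕ
      d v = size (link H v)
      rearrange : ∀ a b c → c * (a * b) ≡ b * (a * c)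
      rearrange = solve-∀
      expand : ∀ v → d v * d v ≡ ∑ Ss (λ E → ⟦ edge H E ⟧ * (⟦ lookup E v ⟧ * d v))
      expand v = trans (cong (d v *_) (trans (size≡count (link H v)) (count-puncture (edge H) v)))
        (trans (sym (∑-*ˡ Ss (d v) _)) (∑-cong Ss λ E →
          trans (cong (d v *_) (⟦⟧-∧ (lookup E v) (edge H E))) (rearrange ⟦ lookup E v ⟧ _ (d v))))

-- The shadow of the link of v is contained in the link of v in the shadow. The index `2 + r`
-- ensures that the `∸ 1` in the shadow of the link does not truncate.
∑-shadowSize-link : ∀ {r} (H : RGraph (2 + r)) →
  ∑ (allFin (n H)) (λ v → shadowSize (link H v)) ≤ suc r * shadowSize H
∑-shadowSize-link {r} H = begin
  ∑ vs (λ v → shadowSize (link H v))             ≡⟨ ∑-cong vs (λ v → shadowSize≡count (link H v)) ⟩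
  ∑ vs (λ v → count (inShadow (link H v)))       ≤⟨ ∑-mono vs (λ v → ∑-mono (allSubsets (n H)) (λ A → ⟦⟧-mono (link-shadow v))) ⟩
  ∑ vs (λ v → count (puncture (inShadow H) v))   ≡⟨ ∑-count-puncture (inShadow H) (λ A A∈ → proj₁ (inShadow⁻ H A∈)) ⟩
  suc r * count (inShadow H)                     ≡⟨ cong (suc r *_) (shadowSize≡count H) ⟨
  suc r * shadowSize H                           ∎
  where
  open ≤-Reasoning
  vs = allFin (n H)
  link-shadow : ∀ v {A} → T (inShadow (link H v) A) → T (puncture (inShadow H) v A)
  link-shadow v {A} A∈ =
    let ∣A∣≡r , B , B∈ , A⊆B = inShadow⁻ (link H v) A∈
        v∉B , B⁺∈H = puncture⁻ (edge H) B∈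
        v∉A = v∉B ∘ A⊆B
    in puncture⁺ (inShadow H) v∉A
         (inShadow⁺ H (trans (∣insert∣ A v v∉A) (cong suc ∣A∣≡r)) B⁺∈H (insert-mono v A⊆B))

-- The induction on the uniformity

shadow-bound : ∀ k (H : RGraph (suc k)) → SymDiffFree H → .{{_ : NonZero (size H)}} →
  suc k ^ suc k * size H ^ k ≤ shadowSize H ^ suc k
-- For uniformity 1 the power `size H ^ 0` is 1 whatever the size, so the claim is that the shadow
-- is nonempty; this comes from H having an edge.
shadow-bound zero H free =
  ≤-trans (>-nonZero⁻¹ (shadowSize H) {{shadow≢∅ H}}) (≤-reflexive (sym (*-identityʳ (shadowSize H))))
shadow-bound k@(suc j) H free = begin
  suc k ^ suc k * m ^ k     ≡⟨ *-assoc (suc k) (suc k ^ k) (m ^ k) ⟩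
  suc k * (suc k ^ k * m ^ k) ≡⟨ cong (suc k *_) (^-distribʳ-* (suc k) m k) ⟨
  suc k * p ^ k             ≤⟨ *-cancelˡ-≤ m (*-cancelˡ-≤ s {{shadow≢∅ H}} (+-cancelʳ-≤ (k * (s * p ^ suc k)) _ _ summed)) ⟩
  s ^ suc k                 ∎
  where
  open ≤-Reasoning
  vs = allFin (n H)
  m = size H
  s = shadowSize H
  -- This is the degree sum. With balanced parts of size t one has p / s = t, d = t^k and σ = k
  -- t^(k-1), whence p^(k+1) σ / k = s^(k+1) d², the equality case of the AM-GM.
  p = suc k * m
  d σ : Fin (n H) → ℕ
  d v = size (link H v)
  σ v = shadowSize (link H v)
  pointwise : ∀ v → suc k * (p ^ k * s) * d v ≤ p ^ suc k * σ v + s ^ suc k * (d v * d v)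
  -- The induction hypothesis asks for a nonempty link; at a vertex of degree 0 the left side
  -- vanishes.
  pointwise v with d v ≟ 0
  ... | yes d≡0 = ≤-trans (≤-reflexive (trans (cong (suc k * (p ^ k * s) *_) d≡0) (*-zeroʳ (suc k * (p ^ k * s))))) z≤n
  ... | no  d≢0 = ≤-trans (≤-reflexive (reassoc k (p ^ k) s (d v)))
    (linearisation j (d v) (σ v) p s
      (shadow-bound j (link H v) (link-symDiffFree H v free) {{≢-nonZero d≢0}}))
    where
    reassoc : ∀ k P s d → (1 + k) * (P * s) * d ≡ (1 + k) * (P * (s * d))
    reassoc = solve-∀
  -- As the degrees add up to p, the left side is k + 1 copies of s p^(k+1). The link shadows
  -- account for k of them on the right; the remaining copy is compared with m s^(k+2), and s m is
  -- then cancelled.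
  summed : s * (m * (suc k * p ^ k)) + k * (s * p ^ suc k) ≤ s * (m * s ^ suc k) + k * (s * p ^ suc k)
  summed = begin
    s * (m * (suc k * p ^ k)) + k * (s * p ^ suc k)       ≡⟨ lhs k m s (p ^ k) ⟩
    suc k * (p ^ k * s) * p                               ≡⟨ cong (suc k * (p ^ k * s) *_) (∑-size-link H) ⟨
    suc k * (p ^ k * s) * ∑ vs d                          ≡⟨ ∑-*ˡ vs (suc k * (p ^ k * s)) d ⟨
    ∑ vs (λ v → suc k * (p ^ k * s) * d v)                ≤⟨ ∑-mono vs pointwise ⟩
    ∑ vs (λ v → p ^ suc k * σ v + s ^ suc k * (d v * d v)) ≡⟨ ∑-+ vs _ _ ⟩
    ∑ vs (λ v → p ^ suc k * σ v) + ∑ vs (λ v → s ^ suc k * (d v * d v)) ≡⟨ cong₂ _+_ (∑-*ˡ vs (p ^ suc k) σ) (∑-*ˡ vs (s ^ suc k) _) ⟩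
    p ^ suc k * ∑ vs σ + s ^ suc k * ∑ vs (λ v → d v * d v) ≤⟨ +-mono-≤ (*-monoʳ-≤ (p ^ suc k) (∑-shadowSize-link H)) (*-monoʳ-≤ (s ^ suc k) (∑-size-link² H free)) ⟩
    p ^ suc k * (k * s) + s ^ suc k * (m * s)             ≡⟨ rhs k m s (p ^ suc k) (s ^ suc k) ⟩
    s * (m * s ^ suc k) + k * (s * p ^ suc k)             ∎
    where
    lhs : ∀ k m s P → s * (m * ((1 + k) * P)) + k * (s * ((1 + k) * m * P)) ≡ (1 + k) * (P * s) * ((1 + k) * m)
    lhs = solve-∀
    rhs : ∀ k m s P S → P * (k * s) + S * (m * s) ≡ s * (m * S) + k * (s * P)
    rhs = solve-∀

-- The real exponent is removed by raising both sides to the power r - 1 and multiplying by r^r.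
theorem4p4 : (r : ℕ) → 2 ≤ r → (H : RGraph r) → Cancellative H →
    (r ^ r) * (size H ^ (r ∸ 1)) ≤ shadowSize H ^ r
theorem4p4 (suc zero) (s≤s ())
theorem4p4 r@(suc (suc k)) _ H cancel with size H ≟ 0
-- The exponent r - 1 is positive here, so the left side is 0 when there are no edges.
... | yes m≡0 = ≤-trans (≤-reflexive (trans (cong (λ m → r ^ r * m ^ suc k) m≡0) (*-zeroʳ (r ^ r)))) z≤n
... | no  m≢0 = shadow-bound (suc k) H (cancellative⇒symDiffFree H cancel) {{≢-nonZero m≢0}}
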